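{- In the 2-layered contextual modal type theory with context variables (defined in the context), algorithmic convertibility is sound with respect to equivalence at layer $1$: \begin{itemize} \item if $\Psi;\Gamma\vdash_1t\mathrel{\widehat{\Longleftrightarrow}}t':T$, then $\Psi;\Gamma\vdash_1t\approx t':T$; \item if $\Psi;\Gamma\vdash_1w\Longleftrightarrow w':T$, then $\Psi;\Gamma\vdash_1w\approx w':T$; \item if $\Psi;\Gamma\vdash_1v\longleftrightarrow v':T$, then $\Psi;\Gamma\vdash_1v\approx v':T$; \item if $\Psi;\Gamma\vdash_1\delta\mathrel{\widehat{\Longleftrightarrow}}\delta':\Delta$, then $\Psi;\Gamma\vdash_1\delta\approx\delta':\Delta$. \end{itemize} Here $w,w'$ range over weak head normal forms and $v,v'$ over neutral forms.
   Context: **The system.** Layers $i\in\{0,1\}$. Local variables $x,y$; global variables $u$; context variables $g$. Expressions are taken up to renaming of bound variables; weakening by unused variables is silent, except for the numeric annotations described below. Types $S,T::=\mathrm{Nat}\mid\square(\Gamma\vdash T)\mid S\to T\mid(g:\mathrm{Ctx})\Rightarrow T$. Global contexts $\Phi,\Psi::=\cdot\mid\Psi,u:(\Gamma\vdash T)\mid\Psi,g:\mathrm{Ctx}$. Local contexts $\Gamma,\Delta::=\cdot\mid g\mid\Gamma,x:T$. $|\Gamma|$ is the number of bindings $x:T$ in $\Gamma$; $\Gamma$ "ends with" $\cdot$ or $g$ according to its base case. Terms $s,t::=x\mid u^\delta\mid\mathrm{zero}\mid\mathrm{succ}\,t\mid\mathrm{box}\,t\mid\mathrm{letbox}\,u\leftarrow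 s\ \mathrm{in}\ t\mid\lambda x.t\mid t\,s\mid\Lambda g.t\mid t\,\$\,\Gamma$. Local substitutions $\delta::=\cdot^m\mid\cdot_g^m\mid\mathrm{wk}_g^m\mid\delta,t/x$ with $m\in\mathbb N$. Global substitutions $\sigma::=\cdot\mid\sigma,t/u\mid\sigma,\Gamma/g$. In $\mathrm{letbox}$, $u$ is bound in $t$; $\lambda x.t$ binds $x$; $\Lambda g.t$ and $(g:\mathrm{Ctx})\Rightarrow T$ bind $g$. **Well-formedness** (premises $\Longrightarrow$ conclusion). $\vdash\cdot$; $\ \vdash\Psi\Longrightarrow\vdash\Psi,g:\mathrm{Ctx}$; $\ \Psi\vdash_0\Gamma,\ \Psi\vdash_0T\Longrightarrow\vdash\Psi,u:(\Gamma\vdash T)$. $\vdash\Psi\Longrightarrow\Psi\vdash_i\cdot$; $\ \vdash\Psi,\ g:\mathrm{Ctx}\in\Psi\Longrightarrow\Psi\vdash_ig$; $\ \Psi\vdash_i\Gamma,\ \Psi\vdash_iT\Longrightarrow\Psi\vdash_i\Gamma,x:T$. $\vdash\Psi\Longrightarrow\Psi\vdash_i\mathrm{Nat}$; $\ \Psi\vdash_iS,\ \Psi\vdash_iT\Longrightarrow\Psi\vdash_iS\to T$; $\ \Psi\vdash_0\Delta,\ \Psi\vdash_0T\Longrightarrow\Psi\vdash_1\square(\Delta\vdash T)$; $\ \Psi,g:\mathrm{Ctx}\vdash_1T\Longrightarrow\Psi\vdash_1(g:\mathrm{Ctx})\Rightarrow T$. **Operations.** Local weakening by $k$ extra local variables,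 written $[p^k]$, adds $k$ to every annotation $m$ of $\cdot^m,\cdot_g^m,\mathrm{wk}_g^m$ that does not occur under a $\mathrm{box}$ (it leaves $\mathrm{box}\,t$ unchanged). Define $\widehat{\cdot^m}=\widehat{\cdot_g^m}=\widehat{\mathrm{wk}_g^m}=m$, $\widehat{\delta,t/x}=\widehat\delta$; $\check{\cdot^m}$ is undefined (no context variable), $\check{\cdot_g^m}=\check{\mathrm{wk}_g^m}=g$, and the check of $\delta,t/x$ is $\check\delta$. Local substitution: $x[\delta]=\delta(x)$, $u^{\delta'}[\delta]=u^{\delta'\circ\delta}$, $(\mathrm{box}\,t)[\delta]=\mathrm{box}\,t$, $(\lambda x.t)[\delta]=\lambda x.(t[\delta[p^1],x/x])$, $(t\,\$\,\Gamma)[\delta]=(t[\delta])\,\$\,\Gamma$, homomorphic otherwise. Composition: $\mathrm{wk}_g^m\circ\delta=\mathrm{wk}_g^{\widehat\delta}$; $\cdot^m\circ\delta=\cdot_{\check\delta}^{\widehat\delta}$ (meaning $\cdot^{\widehat\delta}$ if $\check\delta$ is undefined); $\cdot_g^m\circ\delta=\cdot_g^{\widehat\delta}$; $(\delta',t/x)\circ\delta=(\delta'\circ\delta),t[\delta]/x$. Weakening substitutions: $\mathrm{wk}^m_{\cdot}=\cdot^m$ and $\mathrm{wk}^m_g$ as in the syntax for the two base contexts, $\mathrm{wk}^m_{\Gamma,x:T}=\mathrm{wk}^{1+m}_\Gamma,x/x$; $\mathrm{id}_\Gamma=\mathrm{wk}^0_\Gamma$. The global identity $\mathrm{id}_\Psi$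 sends each $g$ to $g$ and each $u:(\Gamma\vdash T)$ to $u^{\mathrm{id}_\Gamma}$. Global substitution is homomorphic (also inside $\mathrm{box}$, contexts and types, capture-avoiding, extended by $g/g$ or $u^{\mathrm{id}}/u$ under binders of $g$, $u$) with: $x[\sigma]=x$, $g[\sigma]=\sigma(g)$ (base of a local context), $u^\delta[\sigma]=\sigma(u)[\delta[\sigma]]$, $\mathrm{wk}_g^m[\sigma]=\mathrm{wk}^m_{\sigma(g)}$, $\cdot^m[\sigma]=\cdot^m$, $\cdot_g^m[\sigma]=\cdot^{|\sigma(g)|+m}$ if $\sigma(g)$ ends with $\cdot$, and $\cdot_{g'}^{|\sigma(g)|+m}$ if $\sigma(g)$ ends with $g'$. **Typing.** $\Psi\vdash_i\Gamma,\ x:T\in\Gamma\Longrightarrow\Psi;\Gamma\vdash_ix:T$. $\Psi;\Gamma\vdash_i\delta:\Delta,\ u:(\Delta\vdash T)\in\Psi\Longrightarrow\Psi;\Gamma\vdash_iu^\delta:T$. $\Psi\vdash_i\Gamma\Longrightarrow\Psi;\Gamma\vdash_i\mathrm{zero}:\mathrm{Nat}$; $\ \Psi;\Gamma\vdash_it:\mathrm{Nat}\Longrightarrow\Psi;\Gamma\vdash_i\mathrm{succ}\,t:\mathrm{Nat}$. $\Psi;\Gamma,x:S\vdash_it:T\Longrightarrow\Psi;\Gamma\vdash_i\lambda x.t:S\to T$; $\ \Psi;\Gamma\vdash_it:S\to T,\ \Psi;\Gamma\vdash_is:S\Longrightarrow\Psi;\Gamma\vdash_it\,s:T$. $\Psi\vdash_1\Gamma,\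 \Psi;\Delta\vdash_0t:T\Longrightarrow\Psi;\Gamma\vdash_1\mathrm{box}\,t:\square(\Delta\vdash T)$. $\Psi;\Gamma\vdash_1s:\square(\Delta\vdash T),\ \Psi\vdash_0\Delta,\ \Psi\vdash_0T,\ \Psi\vdash_1T',\ \Psi,u:(\Delta\vdash T);\Gamma\vdash_1t:T'\Longrightarrow\Psi;\Gamma\vdash_1\mathrm{letbox}\,u\leftarrow s\ \mathrm{in}\ t:T'$. $\Psi\vdash_1\Gamma,\ \Psi,g:\mathrm{Ctx};\Gamma\vdash_1t:T\Longrightarrow\Psi;\Gamma\vdash_1\Lambda g.t:(g:\mathrm{Ctx})\Rightarrow T$. $\Psi;\Gamma\vdash_1t:(g:\mathrm{Ctx})\Rightarrow T,\ \Psi\vdash_0\Delta\Longrightarrow\Psi;\Gamma\vdash_1t\,\$\,\Delta:T[\mathrm{id}_\Psi,\Delta/g]$. $\Psi\vdash_i\Gamma$, $\Gamma$ ends with $\cdot$, $|\Gamma|=m\Longrightarrow\Psi;\Gamma\vdash_i\cdot^m:\cdot$. $\Psi\vdash_i\Gamma$, $g:\mathrm{Ctx}\in\Psi$, $\Gamma$ ends with $g$, $|\Gamma|=m\Longrightarrow\Psi;\Gamma\vdash_i\cdot_g^m:\cdot$ and $\Psi;\Gamma\vdash_i\mathrm{wk}_g^m:g$. $\Psi;\Gamma\vdash_i\delta:\Delta,\ \Psi;\Gamma\vdash_it:T\Longrightarrow\Psi;\Gamma\vdash_i(\delta,t/x):(\Delta,x:T)$. **Equivalence** $\Psi;\Gamma\vdash_it\approx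 t':T$ and $\Psi;\Gamma\vdash_i\delta\approx\delta':\Delta$, mutually defined. For terms: symmetry, transitivity, and one congruence rule for each typing rule (at the same layers, with typing premises replaced by equivalence premises; for $\mathrm{box}$ the premise is equivalence at layer $0$; for $t\,\$\,\Delta$ the same $\Delta$ on both sides). At layer $1$ only, for well-typed instances: $(\lambda x.t)\,s\approx t[\mathrm{id}_\Gamma,s/x]:T$; $t\approx\lambda x.(t\,x):S\to T$; $\mathrm{letbox}\,u\leftarrow\mathrm{box}\,s\ \mathrm{in}\ t\approx t[\mathrm{id}_\Psi,s/u]:T'$; $(\Lambda g.t)\,\$\,\Delta\approx t[\mathrm{id}_\Psi,\Delta/g]:T[\mathrm{id}_\Psi,\Delta/g]$; $t\approx\Lambda g.(t\,\$\,g):(g:\mathrm{Ctx})\Rightarrow T$. For local substitutions: only the congruence rules given by the constructors. **Weak head reduction** $\Psi;\Gamma\vdash_1t\rightsquigarrow t':T$ (at layer $1$, on well-typed terms): the left-to-right orientations of the three $\beta$ rules above ($\lambda$, $\mathrm{letbox}$ on $\mathrm{box}$, $\Lambda$), closed under the head positions: $t\,s\rightsquigarrow t'\,s$, $t\,\$\,\Delta\rightsquigarrow t'\,\$\,\Delta$ if $t\rightsquigarrow t'$, and $\mathrm{letbox}\,u\leftarrow s\ \mathrm{in}\ t\rightsquigarrow\mathrm{letbox}\,u\leftarrow s'\ \mathrm{in}\ t$ if $s\rightsquigarrow s'$. $\rightsquigarrow^*$ is the reflexive transitive closure (on terms well-typed at the given type). Weak head normal forms $w::=v\mid\mathrm{zero}\mid\mathrm{succ}\,t\mid\mathrm{box}\,t\mid\lambda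 x.t\mid\Lambda g.t$; neutral forms $v::=x\mid u^\delta\mid v\,t\mid\mathrm{letbox}\,u\leftarrow v\ \mathrm{in}\ t\mid v\,\$\,\Gamma$. **Convertibility checking**: $\widehat{\Longleftrightarrow}$ on terms, $\Longleftrightarrow$ on weak head normal forms, $\longleftrightarrow$ on neutral forms, all at layer $1$ (prefix $\Psi;\Gamma\vdash_1$ omitted when unchanged): $t\rightsquigarrow^*w:T,\ t'\rightsquigarrow^*w':T,\ w\Longleftrightarrow w':T\Longrightarrow t\mathrel{\widehat{\Longleftrightarrow}}t':T$. $\Psi\vdash_1\Gamma\Longrightarrow\mathrm{zero}\Longleftrightarrow\mathrm{zero}:\mathrm{Nat}$; $\ t\mathrel{\widehat{\Longleftrightarrow}}t':\mathrm{Nat}\Longrightarrow\mathrm{succ}\,t\Longleftrightarrow\mathrm{succ}\,t':\mathrm{Nat}$; $\ v\longleftrightarrow v':\mathrm{Nat}\Longrightarrow v\Longleftrightarrow v':\mathrm{Nat}$. $\Psi;\Gamma,x:S\vdash_1w\,x\mathrel{\widehat{\Longleftrightarrow}}w'\,x:T\Longrightarrow w\Longleftrightarrow w':S\to T$ (with $w,w'$ locally weakened by one variable in the premise). $\Psi\vdash_1\Gamma,\ \Psi;\Delta\vdash_0t:T\Longrightarrow\mathrm{box}\,t\Longleftrightarrow\mathrm{box}\,t:\square(\Delta\vdash T)$; $\ v\longleftrightarrow v':\square(\Delta\vdash T)\Longrightarrow v\Longleftrightarrow v':\square(\Delta\vdash T)$. $\Psi,g:\mathrm{Ctx};\Gamma\vdash_1w\,\$\,g\mathrel{\widehat{\Longleftrightarrow}}w'\,\$\,g:T\Longrightarrow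 w\Longleftrightarrow w':(g:\mathrm{Ctx})\Rightarrow T$. $\Psi\vdash_1\Gamma,\ x:T\in\Gamma\Longrightarrow x\longleftrightarrow x:T$; $\ \delta\mathrel{\widehat{\Longleftrightarrow}}\delta':\Delta,\ u:(\Delta\vdash T)\in\Psi\Longrightarrow u^\delta\longleftrightarrow u^{\delta'}:T$. $v\longleftrightarrow v':S\to T,\ t\mathrel{\widehat{\Longleftrightarrow}}t':S\Longrightarrow v\,t\longleftrightarrow v'\,t':T$. $v\longleftrightarrow v':\square(\Delta\vdash T),\ \Psi\vdash_1T',\ \Psi,u:(\Delta\vdash T);\Gamma\vdash_1t\mathrel{\widehat{\Longleftrightarrow}}t':T'\Longrightarrow\mathrm{letbox}\,u\leftarrow v\ \mathrm{in}\ t\longleftrightarrow\mathrm{letbox}\,u\leftarrow v'\ \mathrm{in}\ t':T'$. $v\longleftrightarrow v':(g:\mathrm{Ctx})\Rightarrow T,\ \Psi\vdash_0\Delta\Longrightarrow v\,\$\,\Delta\longleftrightarrow v'\,\$\,\Delta:T[\mathrm{id}_\Psi,\Delta/g]$. $\delta\mathrel{\widehat{\Longleftrightarrow}}\delta':\Delta$ is defined pointwise: equal base cases (with the premises of the corresponding typing rules), and $\delta\mathrel{\widehat{\Longleftrightarrow}}\delta':\Delta,\ t\mathrel{\widehat{\Longleftrightarrow}}t':T\Longrightarrow(\delta,t/x)\mathrel{\widehat{\Longleftrightarrow}}(\delta',t'/x):(\Delta,x:T)$.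
   Formalization: The convertibility rule for w ⟺ w′ at (g:Ctx)⇒T additionally requires that w and w′ have type (g:Ctx)⇒T in Ψ;Γ; without this premise the rule relates an ill-typed term to itself and soundness fails. -}

module Defs where

open import Data.List.Base using (List; []; _∷_)
open import Data.List.Membership.Propositional using (_∈_)
open import Data.List.Relation.Binary.Subset.Propositional using (_⊆_)
open import Data.List.Relation.Binary.Subset.Propositional.Properties using (∷⁺ʳ)
open import Data.List.Relation.Unary.Any using (here; there)
open import Data.Maybe.Base using (Maybe; just; nothing)
open import Data.Bool.Base using (if_then_else_)
open import Data.Nat.Base using (ℕ; zero; suc; _+_; _<ᵇ_)
open import Data.Nat.Properties using (+-identityʳ; +-suc)
open import Relation.Binary.PropositionalEquality using (_≡_; refl; cong; cong₂; trans)

infixl 5 _,_ _,ᵗ_ _,ᶜ_ _,ᵛ_ _,u∶_⊢_ _,g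
infixr 6 _⇒_
infixl 7 _·_ _$_
infix  8 _^_

-- Global names are well-scoped de Bruijn indices: a scope lists the kinds of
-- the global bindings, and a global name is a membership proof.  Local names
-- are raw de Bruijn indices, because the number of local variables in scope
-- changes when a context is substituted for a context variable.

data Kind : Set where
  ctx tm : Kind

Scope : Set
Scope = List Kind

pattern hd = here refl

private variable
  Θ Θ′ : Scope

------------------------------------------------------------------------
-- Syntax

mutual
  data Ty (Θ : Scope) : Set where
    Nat : Ty Θ
    □   : LCtx Θ → Ty Θ → Ty Θ
    _⇒_ : Ty Θ → Ty Θ → Ty Θ
    Π   : Ty (ctx ∷ Θ) → Ty Θ               -- (g : Ctx) ⇒ T

  data LCtx (Θ : Scope) : Set where
    ∙   : LCtx Θ
    cv  : ctx ∈ Θ → LCtx Θ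
    _,_ : LCtx Θ → Ty Θ → LCtx Θ

mutual
  data Tm (Θ : Scope) : Set where
    var    : ℕ → Tm Θ
    _^_    : tm ∈ Θ → LSub Θ → Tm Θ
    zero   : Tm Θ
    succ   : Tm Θ → Tm Θ
    box    : Tm Θ → Tm Θ
    letbox : Tm Θ → Tm (tm ∷ Θ) → Tm Θ      -- letbox u ← s in t
    ƛ      : Tm Θ → Tm Θ
    _·_    : Tm Θ → Tm Θ → Tm Θ
    Λ      : Tm (ctx ∷ Θ) → Tm Θ
    _$_    : Tm Θ → LCtx Θ → Tm Θ

  data LSub (Θ : Scope) : Set where
    ∙    : ℕ → LSub Θ
    ∙[_] : ctx ∈ Θ → ℕ → LSub Θ
    wk[_] : ctx ∈ Θ → ℕ → LSub Θ
    _,_  : LSub Θ → Tm Θ → LSub Θ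

data GCtx : Scope → Set where
  ∙       : GCtx []
  _,u∶_⊢_ : GCtx Θ → LCtx Θ → Ty Θ → GCtx (tm ∷ Θ)
  _,g     : GCtx Θ → GCtx (ctx ∷ Θ)

-- σ : GSub Θ Θ′ replaces the names of Θ′ by expressions over Θ.  The entry
-- σ ,ᵛ u′ stands for σ , u′^id / u: going under a letbox binder, the local
-- context Γ of id_Γ is not recoverable from the term.  It is not needed
-- either, since u′^id_Γ [ δ ] is u′^(id_Γ ∘ δ) and id_Γ ∘ δ is δ for
-- every δ with codomain Γ (id-∘ below).
data GSub (Θ : Scope) : Scope → Set where
  ∙    : GSub Θ []
  _,ᵗ_ : GSub Θ Θ′ → Tm Θ → GSub Θ (tm ∷ Θ′)
  _,ᶜ_ : GSub Θ Θ′ → LCtx Θ → GSub Θ (ctx ∷ Θ′)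
  _,ᵛ_ : GSub Θ Θ′ → tm ∈ Θ → GSub Θ (tm ∷ Θ′)

------------------------------------------------------------------------
-- Local contexts and substitutions: length, base and weakenings

∣_∣ : LCtx Θ → ℕ
∣ ∙ ∣     = 0
∣ cv _ ∣  = 0
∣ Γ , _ ∣ = suc ∣ Γ ∣

-- nothing: Γ ends with the empty context; just g: Γ ends with g.
base : LCtx Θ → Maybe (ctx ∈ Θ)
base ∙       = nothing
base (cv g)  = just g
base (Γ , _) = base Γ

hat : LSub Θ → ℕ
hat (∙ m)      = m
hat (∙[ _ ] m) = m
hat (wk[ _ ] m) = m
hat (δ , _)    = hat δ

check : LSub Θ → Maybe (ctx ∈ Θ)
check (∙ _)       = nothing
check (∙[ g ] _)  = just g
check (wk[ g ] _) = just g
check (δ , _)     = check δ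

∙⟨_⟩ : Maybe (ctx ∈ Θ) → ℕ → LSub Θ
∙⟨ nothing ⟩ = ∙
∙⟨ just g ⟩  = ∙[ g ]

wk : ℕ → LCtx Θ → LSub Θ
wk m ∙       = ∙ m
wk m (cv g)  = wk[ g ] m
wk m (Γ , _) = wk (suc m) Γ , var m

id : LCtx Θ → LSub Θ
id = wk 0

------------------------------------------------------------------------
-- Renaming of global names (silent in named syntax)

mutual
  renᵀ : Θ ⊆ Θ′ → Ty Θ → Ty Θ′
  renᵀ ρ Nat     = Nat
  renᵀ ρ (□ Γ T) = □ (renᶜ ρ Γ) (renᵀ ρ T)
  renᵀ ρ (S ⇒ T) = renᵀ ρ S ⇒ renᵀ ρ T
  renᵀ ρ (Π T)   = Π (renᵀ (∷⁺ʳ ctx ρ) T)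

  renᶜ : Θ ⊆ Θ′ → LCtx Θ → LCtx Θ′
  renᶜ ρ ∙       = ∙
  renᶜ ρ (cv g)  = cv (ρ g)
  renᶜ ρ (Γ , T) = renᶜ ρ Γ , renᵀ ρ T

mutual
  ren : Θ ⊆ Θ′ → Tm Θ → Tm Θ′
  ren ρ (var x)      = var x
  ren ρ (u ^ δ)      = ρ u ^ renˢ ρ δ
  ren ρ zero         = zero
  ren ρ (succ t)     = succ (ren ρ t)
  ren ρ (box t)      = box (ren ρ t)
  ren ρ (letbox s t) = letbox (ren ρ s) (ren (∷⁺ʳ tm ρ) t)
  ren ρ (ƛ t)        = ƛ (ren ρ t)
  ren ρ (t · s)      = ren ρ t · ren ρ s
  ren ρ (Λ t)        = Λ (ren (∷⁺ʳ ctx ρ) t)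
  ren ρ (t $ Γ)      = ren ρ t $ renᶜ ρ Γ

  renˢ : Θ ⊆ Θ′ → LSub Θ → LSub Θ′
  renˢ ρ (∙ m)       = ∙ m
  renˢ ρ (∙[ g ] m)  = ∙[ ρ g ] m
  renˢ ρ (wk[ g ] m) = wk[ ρ g ] m
  renˢ ρ (δ , t)     = renˢ ρ δ , ren ρ t

module _ {k : Kind} where
  ↑ᵀ : Ty Θ → Ty (k ∷ Θ)
  ↑ᵀ = renᵀ there

  ↑ᶜ : LCtx Θ → LCtx (k ∷ Θ)
  ↑ᶜ = renᶜ there

  ↑ : Tm Θ → Tm (k ∷ Θ)
  ↑ = ren there

  ↑ˢ : LSub Θ → LSub (k ∷ Θ)
  ↑ˢ = renˢ there

  ↑ᴳ : GSub Θ Θ′ → GSub (k ∷ Θ) Θ′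
  ↑ᴳ ∙        = ∙
  ↑ᴳ (σ ,ᵗ t) = ↑ᴳ σ ,ᵗ ↑ t
  ↑ᴳ (σ ,ᶜ Γ) = ↑ᴳ σ ,ᶜ ↑ᶜ Γ
  ↑ᴳ (σ ,ᵛ u) = ↑ᴳ σ ,ᵛ there u

------------------------------------------------------------------------
-- Local weakening

-- Inserts k local variables outside the c innermost ones; every annotation
-- counts the whole local context, so it grows by k whatever the cutoff is.
mutual
  shift : (c k : ℕ) → Tm Θ → Tm Θ
  shift c k (var x)      = var (if x <ᵇ c then x else k + x)
  shift c k (u ^ δ)      = u ^ shiftˢ c k δ
  shift c k zero         = zero
  shift c k (succ t)     = succ (shift c k t)
  shift c k (box t)      = box t
  shift c k (letbox s t) = letbox (shift c k s) (shift c k t)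
  shift c k (ƛ t)        = ƛ (shift (suc c) k t)
  shift c k (t · s)      = shift c k t · shift c k s
  shift c k (Λ t)        = Λ (shift c k t)
  shift c k (t $ Γ)      = shift c k t $ Γ

  shiftˢ : (c k : ℕ) → LSub Θ → LSub Θ
  shiftˢ c k (∙ m)       = ∙ (k + m)
  shiftˢ c k (∙[ g ] m)  = ∙[ g ] (k + m)
  shiftˢ c k (wk[ g ] m) = wk[ g ] (k + m)
  shiftˢ c k (δ , t)     = shiftˢ c k δ , shift c k t

_[p^_] : Tm Θ → ℕ → Tm Θ
t [p^ k ] = shift 0 k t

_[p^_]ˢ : LSub Θ → ℕ → LSub Θ
δ [p^ k ]ˢ = shiftˢ 0 k δ

------------------------------------------------------------------------
-- Local substitution

-- The base cases are junk: in a well-typed t [ δ ] every variable of t has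
-- an entry in δ.
lookup : LSub Θ → ℕ → Tm Θ
lookup (δ , t) zero    = t
lookup (δ , t) (suc x) = lookup δ x
lookup (∙ _)       x   = var x
lookup (∙[ _ ] _)  x   = var x
lookup (wk[ _ ] _) x   = var x

mutual
  _[_] : Tm Θ → LSub Θ → Tm Θ
  var x      [ δ ] = lookup δ x
  (u ^ δ′)   [ δ ] = u ^ (δ′ ∘ δ)
  zero       [ δ ] = zero
  succ t     [ δ ] = succ (t [ δ ])
  box t      [ δ ] = box t
  letbox s t [ δ ] = letbox (s [ δ ]) (t [ ↑ˢ δ ])
  ƛ t        [ δ ] = ƛ (t [ δ [p^ 1 ]ˢ , var 0 ])
  (t · s)    [ δ ] = t [ δ ] · s [ δ ]
  Λ t        [ δ ] = Λ (t [ ↑ˢ δ ])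
  (t $ Γ)    [ δ ] = t [ δ ] $ Γ

  _∘_ : LSub Θ → LSub Θ → LSub Θ
  ∙ m       ∘ δ = ∙⟨ check δ ⟩ (hat δ)
  ∙[ g ] m  ∘ δ = ∙[ g ] (hat δ)
  wk[ g ] m ∘ δ = wk[ g ] (hat δ)
  (δ′ , t)  ∘ δ = (δ′ ∘ δ) , t [ δ ]

------------------------------------------------------------------------
-- Global substitution

_⟨_⟩ᵍ : ctx ∈ Θ′ → GSub Θ Θ′ → LCtx Θ
hd      ⟨ σ ,ᶜ Γ ⟩ᵍ = Γ
there g ⟨ σ ,ᵗ _ ⟩ᵍ = g ⟨ σ ⟩ᵍ
there g ⟨ σ ,ᶜ _ ⟩ᵍ = g ⟨ σ ⟩ᵍ
there g ⟨ σ ,ᵛ _ ⟩ᵍ = g ⟨ σ ⟩ᵍ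

-- u ⟨ σ , δ ⟩ᵘ is σ(u) [ δ ].
_⟨_,_⟩ᵘ : tm ∈ Θ′ → GSub Θ Θ′ → LSub Θ → Tm Θ
hd      ⟨ σ ,ᵗ t , δ ⟩ᵘ = t [ δ ]
hd      ⟨ σ ,ᵛ u , δ ⟩ᵘ = u ^ δ
there u ⟨ σ ,ᵗ _ , δ ⟩ᵘ = u ⟨ σ , δ ⟩ᵘ
there u ⟨ σ ,ᶜ _ , δ ⟩ᵘ = u ⟨ σ , δ ⟩ᵘ
there u ⟨ σ ,ᵛ _ , δ ⟩ᵘ = u ⟨ σ , δ ⟩ᵘ

extᵍ : GSub Θ Θ′ → GSub (ctx ∷ Θ) (ctx ∷ Θ′)
extᵍ σ = ↑ᴳ σ ,ᶜ cv hd

extᵘ : GSub Θ Θ′ → GSub (tm ∷ Θ) (tm ∷ Θ′)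
extᵘ σ = ↑ᴳ σ ,ᵛ hd

mutual
  _[_]ᵀ : Ty Θ′ → GSub Θ Θ′ → Ty Θ
  Nat     [ σ ]ᵀ = Nat
  □ Γ T   [ σ ]ᵀ = □ (Γ [ σ ]ᶜ) (T [ σ ]ᵀ)
  (S ⇒ T) [ σ ]ᵀ = S [ σ ]ᵀ ⇒ T [ σ ]ᵀ
  Π T     [ σ ]ᵀ = Π (T [ extᵍ σ ]ᵀ)

  _[_]ᶜ : LCtx Θ′ → GSub Θ Θ′ → LCtx Θ
  ∙       [ σ ]ᶜ = ∙
  cv g    [ σ ]ᶜ = g ⟨ σ ⟩ᵍ
  (Γ , T) [ σ ]ᶜ = Γ [ σ ]ᶜ , T [ σ ]ᵀ

mutual
  _[_]ᴳ : Tm Θ′ → GSub Θ Θ′ → Tm Θ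
  var x      [ σ ]ᴳ = var x
  (u ^ δ)    [ σ ]ᴳ = u ⟨ σ , δ [ σ ]ˢᴳ ⟩ᵘ
  zero       [ σ ]ᴳ = zero
  succ t     [ σ ]ᴳ = succ (t [ σ ]ᴳ)
  box t      [ σ ]ᴳ = box (t [ σ ]ᴳ)
  letbox s t [ σ ]ᴳ = letbox (s [ σ ]ᴳ) (t [ extᵘ σ ]ᴳ)
  ƛ t        [ σ ]ᴳ = ƛ (t [ σ ]ᴳ)
  (t · s)    [ σ ]ᴳ = t [ σ ]ᴳ · s [ σ ]ᴳ
  Λ t        [ σ ]ᴳ = Λ (t [ extᵍ σ ]ᴳ)
  (t $ Γ)    [ σ ]ᴳ = t [ σ ]ᴳ $ Γ [ σ ]ᶜ

  _[_]ˢᴳ : LSub Θ′ → GSub Θ Θ′ → LSub Θ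
  ∙ m       [ σ ]ˢᴳ = ∙ m
  ∙[ g ] m  [ σ ]ˢᴳ = ∙⟨ base (g ⟨ σ ⟩ᵍ) ⟩ (∣ g ⟨ σ ⟩ᵍ ∣ + m)
  wk[ g ] m [ σ ]ˢᴳ = wk m (g ⟨ σ ⟩ᵍ)
  (δ , t)   [ σ ]ˢᴳ = δ [ σ ]ˢᴳ , t [ σ ]ᴳ

idᴳ : GCtx Θ → GSub Θ Θ
idᴳ ∙              = ∙
idᴳ (Ψ ,u∶ Γ ⊢ T) = ↑ᴳ (idᴳ Ψ) ,ᵗ hd ^ id (↑ᶜ Γ)
idᴳ (Ψ ,g)         = ↑ᴳ (idᴳ Ψ) ,ᶜ cv hd

------------------------------------------------------------------------
-- Well-formedness and typing

data Layer : Set where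
  𝟘 𝟙 : Layer

private variable
  i       : Layer
  Ψ       : GCtx Θ
  Γ Δ     : LCtx Θ
  S T T′  : Ty Θ

infix 4 _∶_∈ˡ_ _∶_⊢_∈ᵍ_

data _∶_∈ˡ_ : ℕ → Ty Θ → LCtx Θ → Set where
  here  : 0 ∶ T ∈ˡ (Γ , T)
  there : ∀ {x} → x ∶ T ∈ˡ Γ → suc x ∶ T ∈ˡ (Γ , S)

data _∶_⊢_∈ᵍ_ : tm ∈ Θ → LCtx Θ → Ty Θ → GCtx Θ → Set where
  here   : hd ∶ ↑ᶜ Δ ⊢ ↑ᵀ T ∈ᵍ (Ψ ,u∶ Δ ⊢ T)
  thereᵘ : ∀ {u} → u ∶ Δ ⊢ T ∈ᵍ Ψ → there u ∶ ↑ᶜ Δ ⊢ ↑ᵀ T ∈ᵍ (Ψ ,u∶ Γ ⊢ S)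
  thereᵍ : ∀ {u} → u ∶ Δ ⊢ T ∈ᵍ Ψ → there u ∶ ↑ᶜ Δ ⊢ ↑ᵀ T ∈ᵍ (Ψ ,g)

infix 3 ⊢_ _⊢ᶜ[_]_ _⊢ᵀ[_]_ _⨾_⊢[_]_∶_ _⨾_⊢ˢ[_]_∶_

-- By scoping, every context variable of the scope is bound in Ψ, so the
-- premise g : Ctx ∈ Ψ leaves no trace here and in the typing rules.
mutual
  data ⊢_ : GCtx Θ → Set where
    ⊢∙ : ⊢ ∙
    ⊢g : ⊢ Ψ → ⊢ Ψ ,g
    ⊢u : Ψ ⊢ᶜ[ 𝟘 ] Γ → Ψ ⊢ᵀ[ 𝟘 ] T → ⊢ Ψ ,u∶ Γ ⊢ T

  data _⊢ᶜ[_]_ : GCtx Θ → Layer → LCtx Θ → Set where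
    ⊢∙  : ⊢ Ψ → Ψ ⊢ᶜ[ i ] ∙
    ⊢cv : ∀ {g} → ⊢ Ψ → Ψ ⊢ᶜ[ i ] cv g
    ⊢,  : Ψ ⊢ᶜ[ i ] Γ → Ψ ⊢ᵀ[ i ] T → Ψ ⊢ᶜ[ i ] Γ , T

  data _⊢ᵀ[_]_ : GCtx Θ → Layer → Ty Θ → Set where
    ⊢Nat : ⊢ Ψ → Ψ ⊢ᵀ[ i ] Nat
    ⊢⇒   : Ψ ⊢ᵀ[ i ] S → Ψ ⊢ᵀ[ i ] T → Ψ ⊢ᵀ[ i ] S ⇒ T
    ⊢□   : Ψ ⊢ᶜ[ 𝟘 ] Δ → Ψ ⊢ᵀ[ 𝟘 ] T → Ψ ⊢ᵀ[ 𝟙 ] □ Δ T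
    ⊢Π   : Ψ ,g ⊢ᵀ[ 𝟙 ] T → Ψ ⊢ᵀ[ 𝟙 ] Π T

private variable
  m           : ℕ
  x           : ℕ
  g           : ctx ∈ Θ
  u           : tm ∈ Θ
  s s′ t t′ t″ : Tm Θ
  v v′ w w′   : Tm Θ
  δ δ′ δ″     : LSub Θ

mutual
  data _⨾_⊢[_]_∶_ : GCtx Θ → LCtx Θ → Layer → Tm Θ → Ty Θ → Set where
    ⊢var    : Ψ ⊢ᶜ[ i ] Γ → x ∶ T ∈ˡ Γ → Ψ ⨾ Γ ⊢[ i ] var x ∶ T
    ⊢^      : Ψ ⨾ Γ ⊢ˢ[ i ] δ ∶ Δ → u ∶ Δ ⊢ T ∈ᵍ Ψ → Ψ ⨾ Γ ⊢[ i ] u ^ δ ∶ T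
    ⊢zero   : Ψ ⊢ᶜ[ i ] Γ → Ψ ⨾ Γ ⊢[ i ] zero ∶ Nat
    ⊢succ   : Ψ ⨾ Γ ⊢[ i ] t ∶ Nat → Ψ ⨾ Γ ⊢[ i ] succ t ∶ Nat
    ⊢ƛ      : Ψ ⨾ (Γ , S) ⊢[ i ] t ∶ T → Ψ ⨾ Γ ⊢[ i ] ƛ t ∶ S ⇒ T
    ⊢·      : Ψ ⨾ Γ ⊢[ i ] t ∶ S ⇒ T → Ψ ⨾ Γ ⊢[ i ] s ∶ S → Ψ ⨾ Γ ⊢[ i ] t · s ∶ T
    ⊢box    : Ψ ⊢ᶜ[ 𝟙 ] Γ → Ψ ⨾ Δ ⊢[ 𝟘 ] t ∶ T → Ψ ⨾ Γ ⊢[ 𝟙 ] box t ∶ □ Δ T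
    ⊢letbox : Ψ ⨾ Γ ⊢[ 𝟙 ] s ∶ □ Δ T → Ψ ⊢ᶜ[ 𝟘 ] Δ → Ψ ⊢ᵀ[ 𝟘 ] T → Ψ ⊢ᵀ[ 𝟙 ] T′ →
              (Ψ ,u∶ Δ ⊢ T) ⨾ ↑ᶜ Γ ⊢[ 𝟙 ] t ∶ ↑ᵀ T′ →
              Ψ ⨾ Γ ⊢[ 𝟙 ] letbox s t ∶ T′
    ⊢Λ      : Ψ ⊢ᶜ[ 𝟙 ] Γ → (Ψ ,g) ⨾ ↑ᶜ Γ ⊢[ 𝟙 ] t ∶ T → Ψ ⨾ Γ ⊢[ 𝟙 ] Λ t ∶ Π T
    ⊢$      : Ψ ⨾ Γ ⊢[ 𝟙 ] t ∶ Π T → Ψ ⊢ᶜ[ 𝟘 ] Δ →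
              Ψ ⨾ Γ ⊢[ 𝟙 ] t $ Δ ∶ T [ idᴳ Ψ ,ᶜ Δ ]ᵀ

  data _⨾_⊢ˢ[_]_∶_ : GCtx Θ → LCtx Θ → Layer → LSub Θ → LCtx Θ → Set where
    ⊢∙   : Ψ ⊢ᶜ[ i ] Γ → base Γ ≡ nothing → ∣ Γ ∣ ≡ m → Ψ ⨾ Γ ⊢ˢ[ i ] ∙ m ∶ ∙
    ⊢∙[] : Ψ ⊢ᶜ[ i ] Γ → base Γ ≡ just g → ∣ Γ ∣ ≡ m → Ψ ⨾ Γ ⊢ˢ[ i ] ∙[ g ] m ∶ ∙
    ⊢wk  : Ψ ⊢ᶜ[ i ] Γ → base Γ ≡ just g → ∣ Γ ∣ ≡ m → Ψ ⨾ Γ ⊢ˢ[ i ] wk[ g ] m ∶ cv g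
    ⊢,   : Ψ ⨾ Γ ⊢ˢ[ i ] δ ∶ Δ → Ψ ⨾ Γ ⊢[ i ] t ∶ T → Ψ ⨾ Γ ⊢ˢ[ i ] δ , t ∶ Δ , T

wk-∘ : ∀ m → Ψ ⨾ Γ ⊢ˢ[ i ] δ ∶ Δ →
       (∀ y → lookup δ′ (y + m) ≡ lookup δ y) → hat δ′ ≡ hat δ → check δ′ ≡ check δ →
       wk m Δ ∘ δ′ ≡ δ
wk-∘ m (⊢∙ _ _ _)   l h c = cong₂ ∙⟨_⟩ c h
wk-∘ m (⊢∙[] _ _ _) l h c = cong₂ ∙⟨_⟩ c h
wk-∘ m (⊢wk _ _ _)  l h c = cong wk[ _ ] h
wk-∘ {δ′ = δ′} m (⊢, ⊢δ ⊢t) l h c = cong₂ _,_ (wk-∘ (suc m) ⊢δ l′ h c) (l 0)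
  where l′ = λ y → trans (cong (lookup δ′) (+-suc y m)) (l (suc y))

id-∘ : Ψ ⨾ Γ ⊢ˢ[ i ] δ ∶ Δ → id Δ ∘ δ ≡ δ
id-∘ {δ = δ} ⊢δ = wk-∘ 0 ⊢δ (λ y → cong (lookup δ) (+-identityʳ y)) refl refl

------------------------------------------------------------------------
-- Equivalence

infix 3 _⨾_⊢[_]_≈_∶_ _⨾_⊢ˢ[_]_≈_∶_

mutual
  data _⨾_⊢[_]_≈_∶_ : GCtx Θ → LCtx Θ → Layer → Tm Θ → Tm Θ → Ty Θ → Set where
    ≈-sym    : Ψ ⨾ Γ ⊢[ i ] t ≈ t′ ∶ T → Ψ ⨾ Γ ⊢[ i ] t′ ≈ t ∶ T
    ≈-trans  : Ψ ⨾ Γ ⊢[ i ] t ≈ t′ ∶ T → Ψ ⨾ Γ ⊢[ i ] t′ ≈ t″ ∶ T →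
               Ψ ⨾ Γ ⊢[ i ] t ≈ t″ ∶ T

    ≈-var    : Ψ ⊢ᶜ[ i ] Γ → x ∶ T ∈ˡ Γ → Ψ ⨾ Γ ⊢[ i ] var x ≈ var x ∶ T
    ≈-^      : Ψ ⨾ Γ ⊢ˢ[ i ] δ ≈ δ′ ∶ Δ → u ∶ Δ ⊢ T ∈ᵍ Ψ →
               Ψ ⨾ Γ ⊢[ i ] u ^ δ ≈ u ^ δ′ ∶ T
    ≈-zero   : Ψ ⊢ᶜ[ i ] Γ → Ψ ⨾ Γ ⊢[ i ] zero ≈ zero ∶ Nat
    ≈-succ   : Ψ ⨾ Γ ⊢[ i ] t ≈ t′ ∶ Nat → Ψ ⨾ Γ ⊢[ i ] succ t ≈ succ t′ ∶ Nat
    ≈-ƛ      : Ψ ⨾ (Γ , S) ⊢[ i ] t ≈ t′ ∶ T → Ψ ⨾ Γ ⊢[ i ] ƛ t ≈ ƛ t′ ∶ S ⇒ T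
    ≈-·      : Ψ ⨾ Γ ⊢[ i ] t ≈ t′ ∶ S ⇒ T → Ψ ⨾ Γ ⊢[ i ] s ≈ s′ ∶ S →
               Ψ ⨾ Γ ⊢[ i ] t · s ≈ t′ · s′ ∶ T
    ≈-box    : Ψ ⊢ᶜ[ 𝟙 ] Γ → Ψ ⨾ Δ ⊢[ 𝟘 ] t ≈ t′ ∶ T →
               Ψ ⨾ Γ ⊢[ 𝟙 ] box t ≈ box t′ ∶ □ Δ T
    ≈-letbox : Ψ ⨾ Γ ⊢[ 𝟙 ] s ≈ s′ ∶ □ Δ T →
               Ψ ⊢ᶜ[ 𝟘 ] Δ → Ψ ⊢ᵀ[ 𝟘 ] T → Ψ ⊢ᵀ[ 𝟙 ] T′ →
               (Ψ ,u∶ Δ ⊢ T) ⨾ ↑ᶜ Γ ⊢[ 𝟙 ] t ≈ t′ ∶ ↑ᵀ T′ →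
               Ψ ⨾ Γ ⊢[ 𝟙 ] letbox s t ≈ letbox s′ t′ ∶ T′
    ≈-Λ      : Ψ ⊢ᶜ[ 𝟙 ] Γ → (Ψ ,g) ⨾ ↑ᶜ Γ ⊢[ 𝟙 ] t ≈ t′ ∶ T →
               Ψ ⨾ Γ ⊢[ 𝟙 ] Λ t ≈ Λ t′ ∶ Π T
    ≈-$      : Ψ ⨾ Γ ⊢[ 𝟙 ] t ≈ t′ ∶ Π T → Ψ ⊢ᶜ[ 𝟘 ] Δ →
               Ψ ⨾ Γ ⊢[ 𝟙 ] t $ Δ ≈ t′ $ Δ ∶ T [ idᴳ Ψ ,ᶜ Δ ]ᵀ

    β-ƛ      : Ψ ⨾ (Γ , S) ⊢[ 𝟙 ] t ∶ T → Ψ ⨾ Γ ⊢[ 𝟙 ] s ∶ S →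
               Ψ ⨾ Γ ⊢[ 𝟙 ] ƛ t · s ≈ t [ id Γ , s ] ∶ T
    η-⇒      : Ψ ⨾ Γ ⊢[ 𝟙 ] t ∶ S ⇒ T →
               Ψ ⨾ Γ ⊢[ 𝟙 ] t ≈ ƛ (t [p^ 1 ] · var 0) ∶ S ⇒ T
    β-letbox : Ψ ⊢ᶜ[ 𝟙 ] Γ → Ψ ⨾ Δ ⊢[ 𝟘 ] s ∶ T →
               Ψ ⊢ᶜ[ 𝟘 ] Δ → Ψ ⊢ᵀ[ 𝟘 ] T → Ψ ⊢ᵀ[ 𝟙 ] T′ →
               (Ψ ,u∶ Δ ⊢ T) ⨾ ↑ᶜ Γ ⊢[ 𝟙 ] t ∶ ↑ᵀ T′ →
               Ψ ⨾ Γ ⊢[ 𝟙 ] letbox (box s) t ≈ t [ idᴳ Ψ ,ᵗ s ]ᴳ ∶ T′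
    β-Λ      : Ψ ⊢ᶜ[ 𝟙 ] Γ → (Ψ ,g) ⨾ ↑ᶜ Γ ⊢[ 𝟙 ] t ∶ T → Ψ ⊢ᶜ[ 𝟘 ] Δ →
               Ψ ⨾ Γ ⊢[ 𝟙 ] Λ t $ Δ ≈ t [ idᴳ Ψ ,ᶜ Δ ]ᴳ ∶ T [ idᴳ Ψ ,ᶜ Δ ]ᵀ
    η-Π      : Ψ ⨾ Γ ⊢[ 𝟙 ] t ∶ Π T → Ψ ⨾ Γ ⊢[ 𝟙 ] t ≈ Λ (↑ t $ cv hd) ∶ Π T

  data _⨾_⊢ˢ[_]_≈_∶_ : GCtx Θ → LCtx Θ → Layer → LSub Θ → LSub Θ → LCtx Θ → Set where
    ≈-∙   : Ψ ⊢ᶜ[ i ] Γ → base Γ ≡ nothing → ∣ Γ ∣ ≡ m → Ψ ⨾ Γ ⊢ˢ[ i ] ∙ m ≈ ∙ m ∶ ∙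
    ≈-∙[] : Ψ ⊢ᶜ[ i ] Γ → base Γ ≡ just g → ∣ Γ ∣ ≡ m →
            Ψ ⨾ Γ ⊢ˢ[ i ] ∙[ g ] m ≈ ∙[ g ] m ∶ ∙
    ≈-wk  : Ψ ⊢ᶜ[ i ] Γ → base Γ ≡ just g → ∣ Γ ∣ ≡ m →
            Ψ ⨾ Γ ⊢ˢ[ i ] wk[ g ] m ≈ wk[ g ] m ∶ cv g
    ≈-,   : Ψ ⨾ Γ ⊢ˢ[ i ] δ ≈ δ′ ∶ Δ → Ψ ⨾ Γ ⊢[ i ] t ≈ t′ ∶ T →
            Ψ ⨾ Γ ⊢ˢ[ i ] δ , t ≈ δ′ , t′ ∶ Δ , T

------------------------------------------------------------------------
-- Weak head reduction and weak head normal forms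

infix 3 _⨾_⊢_↝_∶_ _⨾_⊢_↝*_∶_

data _⨾_⊢_↝_∶_ : GCtx Θ → LCtx Θ → Tm Θ → Tm Θ → Ty Θ → Set where
  ↝-β-ƛ      : Ψ ⨾ (Γ , S) ⊢[ 𝟙 ] t ∶ T → Ψ ⨾ Γ ⊢[ 𝟙 ] s ∶ S →
               Ψ ⨾ Γ ⊢ ƛ t · s ↝ t [ id Γ , s ] ∶ T
  ↝-β-letbox : Ψ ⊢ᶜ[ 𝟙 ] Γ → Ψ ⨾ Δ ⊢[ 𝟘 ] s ∶ T →
               Ψ ⊢ᶜ[ 𝟘 ] Δ → Ψ ⊢ᵀ[ 𝟘 ] T → Ψ ⊢ᵀ[ 𝟙 ] T′ →
               (Ψ ,u∶ Δ ⊢ T) ⨾ ↑ᶜ Γ ⊢[ 𝟙 ] t ∶ ↑ᵀ T′ →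
               Ψ ⨾ Γ ⊢ letbox (box s) t ↝ t [ idᴳ Ψ ,ᵗ s ]ᴳ ∶ T′
  ↝-β-Λ      : Ψ ⊢ᶜ[ 𝟙 ] Γ → (Ψ ,g) ⨾ ↑ᶜ Γ ⊢[ 𝟙 ] t ∶ T → Ψ ⊢ᶜ[ 𝟘 ] Δ →
               Ψ ⨾ Γ ⊢ Λ t $ Δ ↝ t [ idᴳ Ψ ,ᶜ Δ ]ᴳ ∶ T [ idᴳ Ψ ,ᶜ Δ ]ᵀ
  ↝-·        : Ψ ⨾ Γ ⊢ t ↝ t′ ∶ S ⇒ T → Ψ ⨾ Γ ⊢[ 𝟙 ] s ∶ S →
               Ψ ⨾ Γ ⊢ t · s ↝ t′ · s ∶ T
  ↝-$        : Ψ ⨾ Γ ⊢ t ↝ t′ ∶ Π T → Ψ ⊢ᶜ[ 𝟘 ] Δ →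
               Ψ ⨾ Γ ⊢ t $ Δ ↝ t′ $ Δ ∶ T [ idᴳ Ψ ,ᶜ Δ ]ᵀ
  ↝-letbox   : Ψ ⨾ Γ ⊢ s ↝ s′ ∶ □ Δ T →
               Ψ ⊢ᶜ[ 𝟘 ] Δ → Ψ ⊢ᵀ[ 𝟘 ] T → Ψ ⊢ᵀ[ 𝟙 ] T′ →
               (Ψ ,u∶ Δ ⊢ T) ⨾ ↑ᶜ Γ ⊢[ 𝟙 ] t ∶ ↑ᵀ T′ →
               Ψ ⨾ Γ ⊢ letbox s t ↝ letbox s′ t ∶ T′

data _⨾_⊢_↝*_∶_ : GCtx Θ → LCtx Θ → Tm Θ → Tm Θ → Ty Θ → Set where
  ε   : Ψ ⨾ Γ ⊢[ 𝟙 ] t ∶ T → Ψ ⨾ Γ ⊢ t ↝* t ∶ T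
  _◅_ : Ψ ⨾ Γ ⊢ t ↝ t′ ∶ T → Ψ ⨾ Γ ⊢ t′ ↝* t″ ∶ T → Ψ ⨾ Γ ⊢ t ↝* t″ ∶ T

data Neutral {Θ : Scope} : Tm Θ → Set where
  var    : Neutral (var x)
  gvar   : Neutral (u ^ δ)
  app    : Neutral v → Neutral (v · t)
  letbox : Neutral v → Neutral (letbox v t)
  inst   : Neutral v → Neutral (v $ Γ)

data Whnf {Θ : Scope} : Tm Θ → Set where
  neutral : Neutral v → Whnf v
  zero    : Whnf zero
  succ    : Whnf (succ t)
  box     : Whnf (box t)
  ƛ       : Whnf (ƛ t)
  Λ       : Whnf (Λ t)

------------------------------------------------------------------------
-- Convertibility checking

infix 3 _⨾_⊢_⟺̂_∶_ _⨾_⊢_⟺_∶_ _⨾_⊢_⟷_∶_ _⨾_⊢ˢ_⟺̂_∶_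

-- ⟺ relates only weak head normal forms and ⟷ only neutral forms: the η
-- rules say so explicitly, the other rules by the shape of their conclusions.
--
-- ⟺-Π also records that the terms compared at Π T have that type.  This
-- does not follow from the last premise, as terms carry no type annotations.
-- For r = letbox u ← x in ƛ f. Λ g. f (x a variable of box type, u unused),
-- r (ƛ z. z) $ g is convertible to itself at S ⇒ S with S = □ (g ⊢ Nat), but
-- r (ƛ z. z) does not have type (g : Ctx) ⇒ S ⇒ S, because f is bound
-- outside of g.  For ⟺-⇒ the corresponding typings do follow.
mutual
  data _⨾_⊢_⟺̂_∶_ : GCtx Θ → LCtx Θ → Tm Θ → Tm Θ → Ty Θ → Set where
    ⟺̂-↝* : Ψ ⨾ Γ ⊢ t ↝* w ∶ T → Ψ ⨾ Γ ⊢ t′ ↝* w′ ∶ T → Ψ ⨾ Γ ⊢ w ⟺ w′ ∶ T →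
            Ψ ⨾ Γ ⊢ t ⟺̂ t′ ∶ T

  data _⨾_⊢_⟺_∶_ : GCtx Θ → LCtx Θ → Tm Θ → Tm Θ → Ty Θ → Set where
    ⟺-zero : Ψ ⊢ᶜ[ 𝟙 ] Γ → Ψ ⨾ Γ ⊢ zero ⟺ zero ∶ Nat
    ⟺-succ : Ψ ⨾ Γ ⊢ t ⟺̂ t′ ∶ Nat → Ψ ⨾ Γ ⊢ succ t ⟺ succ t′ ∶ Nat
    ⟺-Nat  : Ψ ⨾ Γ ⊢ v ⟷ v′ ∶ Nat → Ψ ⨾ Γ ⊢ v ⟺ v′ ∶ Nat
    ⟺-⇒    : Whnf w → Whnf w′ →
             Ψ ⨾ (Γ , S) ⊢ w [p^ 1 ] · var 0 ⟺̂ w′ [p^ 1 ] · var 0 ∶ T →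
             Ψ ⨾ Γ ⊢ w ⟺ w′ ∶ S ⇒ T
    ⟺-box  : Ψ ⊢ᶜ[ 𝟙 ] Γ → Ψ ⨾ Δ ⊢[ 𝟘 ] t ∶ T → Ψ ⨾ Γ ⊢ box t ⟺ box t ∶ □ Δ T
    ⟺-□    : Ψ ⨾ Γ ⊢ v ⟷ v′ ∶ □ Δ T → Ψ ⨾ Γ ⊢ v ⟺ v′ ∶ □ Δ T
    ⟺-Π    : Whnf w → Whnf w′ → Ψ ⨾ Γ ⊢[ 𝟙 ] w ∶ Π T → Ψ ⨾ Γ ⊢[ 𝟙 ] w′ ∶ Π T →
             (Ψ ,g) ⨾ ↑ᶜ Γ ⊢ ↑ w $ cv hd ⟺̂ ↑ w′ $ cv hd ∶ T →
             Ψ ⨾ Γ ⊢ w ⟺ w′ ∶ Π T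

  data _⨾_⊢_⟷_∶_ : GCtx Θ → LCtx Θ → Tm Θ → Tm Θ → Ty Θ → Set where
    ⟷-var    : Ψ ⊢ᶜ[ 𝟙 ] Γ → x ∶ T ∈ˡ Γ → Ψ ⨾ Γ ⊢ var x ⟷ var x ∶ T
    ⟷-^      : Ψ ⨾ Γ ⊢ˢ δ ⟺̂ δ′ ∶ Δ → u ∶ Δ ⊢ T ∈ᵍ Ψ → Ψ ⨾ Γ ⊢ u ^ δ ⟷ u ^ δ′ ∶ T
    ⟷-·      : Ψ ⨾ Γ ⊢ v ⟷ v′ ∶ S ⇒ T → Ψ ⨾ Γ ⊢ t ⟺̂ t′ ∶ S →
               Ψ ⨾ Γ ⊢ v · t ⟷ v′ · t′ ∶ T
    ⟷-letbox : Ψ ⨾ Γ ⊢ v ⟷ v′ ∶ □ Δ T → Ψ ⊢ᵀ[ 𝟙 ] T′ →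
               (Ψ ,u∶ Δ ⊢ T) ⨾ ↑ᶜ Γ ⊢ t ⟺̂ t′ ∶ ↑ᵀ T′ →
               Ψ ⨾ Γ ⊢ letbox v t ⟷ letbox v′ t′ ∶ T′
    ⟷-$      : Ψ ⨾ Γ ⊢ v ⟷ v′ ∶ Π T → Ψ ⊢ᶜ[ 𝟘 ] Δ →
               Ψ ⨾ Γ ⊢ v $ Δ ⟷ v′ $ Δ ∶ T [ idᴳ Ψ ,ᶜ Δ ]ᵀ

  data _⨾_⊢ˢ_⟺̂_∶_ : GCtx Θ → LCtx Θ → LSub Θ → LSub Θ → LCtx Θ → Set where
    ⟺̂-∙   : Ψ ⊢ᶜ[ 𝟙 ] Γ → base Γ ≡ nothing → ∣ Γ ∣ ≡ m → Ψ ⨾ Γ ⊢ˢ ∙ m ⟺̂ ∙ m ∶ ∙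
    ⟺̂-∙[] : Ψ ⊢ᶜ[ 𝟙 ] Γ → base Γ ≡ just g → ∣ Γ ∣ ≡ m →
             Ψ ⨾ Γ ⊢ˢ ∙[ g ] m ⟺̂ ∙[ g ] m ∶ ∙
    ⟺̂-wk  : Ψ ⊢ᶜ[ 𝟙 ] Γ → base Γ ≡ just g → ∣ Γ ∣ ≡ m →
             Ψ ⨾ Γ ⊢ˢ wk[ g ] m ⟺̂ wk[ g ] m ∶ cv g
    ⟺̂-,   : Ψ ⨾ Γ ⊢ˢ δ ⟺̂ δ′ ∶ Δ → Ψ ⨾ Γ ⊢ t ⟺̂ t′ ∶ T →
             Ψ ⨾ Γ ⊢ˢ δ , t ⟺̂ δ′ , t′ ∶ Δ , T

{-# OPTIONS --safe #-}
-- A reduction step is an instance of a β rule under congruences, hence an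
-- equivalence.  Both sides of t ⟺̂ t′ are well typed simply because the source
-- of a reduction sequence is, so neither a substitution lemma nor subject
-- reduction is needed.  At function types the conclusion comes from η, which
-- requires w ∶ S ⇒ T; this follows from the typing of w [p^ 1 ] · var 0 by
-- strengthening.

module Submission where

open import Defs
open import Data.Bool.Base using (if_then_else_)
open import Data.Bool.Properties using (if-float)
open import Data.List.Relation.Binary.Subset.Propositional using (_⊆_)
open import Data.Nat.Base using (ℕ; zero; suc; _<ᵇ_)
open import Data.Nat.Properties using (suc-injective)
open import Data.Product.Base using (_×_; proj₁) renaming (_,_ to ⟨_,_⟩)
open import Relation.Binary.PropositionalEquality using (_≡_; refl; cong; subst; sym; trans)

private variable
  Θ Θ′   : Scope
  i      : Layer
  c      : ℕ
  Ψ      : GCtx Θ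
  Γ Γ′ Δ : LCtx Θ
  S T    : Ty Θ
  t t′   : Tm Θ
  w w′   : Tm Θ
  v v′   : Tm Θ
  δ δ′   : LSub Θ

wf-ctx⇒wf-gctx : Ψ ⊢ᶜ[ i ] Γ → ⊢ Ψ
wf-ctx⇒wf-gctx (⊢∙ ⊢Ψ)   = ⊢Ψ
wf-ctx⇒wf-gctx (⊢cv ⊢Ψ)  = ⊢Ψ
wf-ctx⇒wf-gctx (⊢, ⊢Γ _) = wf-ctx⇒wf-gctx ⊢Γ

mutual
  -- Together with `wf-ctx⇒wf-gctx` this recovers well-formedness premises that the convertibility
  -- rules omit but the congruence rules demand: `Δ` and `T` for `≈-letbox`, `Γ` for `≈-Λ`.
  typed⇒wf-ctx : Ψ ⨾ Γ ⊢[ i ] t ∶ T → Ψ ⊢ᶜ[ i ] Γ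
  typed⇒wf-ctx (⊢var ⊢Γ _)           = ⊢Γ
  typed⇒wf-ctx (⊢^ ⊢δ _)             = typedˢ⇒wf-ctx ⊢δ
  typed⇒wf-ctx (⊢zero ⊢Γ)            = ⊢Γ
  typed⇒wf-ctx (⊢succ ⊢t)            = typed⇒wf-ctx ⊢t
  typed⇒wf-ctx (⊢ƛ ⊢t) with ⊢, ⊢Γ _ ← typed⇒wf-ctx ⊢t = ⊢Γ
  typed⇒wf-ctx (⊢· ⊢t _)             = typed⇒wf-ctx ⊢t
  typed⇒wf-ctx (⊢box ⊢Γ _)           = ⊢Γ
  typed⇒wf-ctx (⊢letbox ⊢s _ _ _ _)  = typed⇒wf-ctx ⊢s
  typed⇒wf-ctx (⊢Λ ⊢Γ _)             = ⊢Γ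
  typed⇒wf-ctx (⊢$ ⊢t _)             = typed⇒wf-ctx ⊢t

  typedˢ⇒wf-ctx : Ψ ⨾ Γ ⊢ˢ[ i ] δ ∶ Δ → Ψ ⊢ᶜ[ i ] Γ
  typedˢ⇒wf-ctx (⊢∙ ⊢Γ _ _)   = ⊢Γ
  typedˢ⇒wf-ctx (⊢∙[] ⊢Γ _ _) = ⊢Γ
  typedˢ⇒wf-ctx (⊢wk ⊢Γ _ _)  = ⊢Γ
  typedˢ⇒wf-ctx (⊢, ⊢δ _)     = typedˢ⇒wf-ctx ⊢δ

-- The effect of `shift c 1` on local contexts. Types contain no local variables, so the bindings
-- inside the inserted one are copied unchanged.
data Inserted {Θ : Scope} : ℕ → LCtx Θ → LCtx Θ → Set where
  here  : Inserted 0 Γ (Γ , S)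
  there : Inserted c Γ Γ′ → Inserted (suc c) (Γ , S) (Γ′ , S)

-- Lets strengthening pass under `letbox` and `Λ`, whose bodies are typed in the renamed context
-- `↑ᶜ Γ`.
renᶜ-Inserted : (ρ : Θ ⊆ Θ′) → Inserted c Γ Γ′ → Inserted c (renᶜ ρ Γ) (renᶜ ρ Γ′)
renᶜ-Inserted ρ here      = here
renᶜ-Inserted ρ (there p) = there (renᶜ-Inserted ρ p)

Inserted-∣∣ : Inserted c Γ Γ′ → ∣ Γ′ ∣ ≡ suc ∣ Γ ∣
Inserted-∣∣ here      = refl
Inserted-∣∣ (there p) = cong suc (Inserted-∣∣ p)

Inserted-base : Inserted c Γ Γ′ → base Γ′ ≡ base Γ
Inserted-base here      = refl
Inserted-base (there p) = Inserted-base p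

strengthenᶜ : Inserted c Γ Γ′ → Ψ ⊢ᶜ[ i ] Γ′ → Ψ ⊢ᶜ[ i ] Γ
strengthenᶜ here      (⊢, ⊢Γ _)   = ⊢Γ
strengthenᶜ (there p) (⊢, ⊢Γ′ ⊢S) = ⊢, (strengthenᶜ p ⊢Γ′) ⊢S

strengthen-∈ : Inserted c Γ Γ′ → ∀ x → (if x <ᵇ c then x else suc x) ∶ T ∈ˡ Γ′ → x ∶ T ∈ˡ Γ
strengthen-∈ here x (there x∈) = x∈
strengthen-∈ (there p) zero here = here
-- Pulling `suc` out of both branches turns the index into a successor, so that the membership must
-- be a `there`.
strengthen-∈ {c = suc c} {T = T} (there p) (suc x) x∈
  with there x∈′ ← subst (λ y → y ∶ T ∈ˡ _) (sym (if-float suc (x <ᵇ c))) x∈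
  = there (strengthen-∈ p x x∈′)

module _ (p : Inserted c Γ Γ′) where
  strengthen-base : ∀ {b} → base Γ′ ≡ b → base Γ ≡ b
  strengthen-base = trans (sym (Inserted-base p))

  -- The 1 that shifting adds to an annotation counts exactly the inserted binding, wherever it
  -- lies.
  strengthen-∣∣ : ∀ {m} → ∣ Γ′ ∣ ≡ suc m → ∣ Γ ∣ ≡ m
  strengthen-∣∣ eq = suc-injective (trans (sym (Inserted-∣∣ p)) eq)

mutual
  -- A shifted term never mentions the inserted variable. Recursion is on the unshifted `t`, so that
  -- `shift` computes and determines the typing rule. The content of a `box` is typed in its own
  -- context and is left alone by `shift`, so its derivation is reused.
  strengthen : Inserted c Γ Γ′ → ∀ t → Ψ ⨾ Γ′ ⊢[ i ] shift c 1 t ∶ T → Ψ ⨾ Γ ⊢[ i ] t ∶ T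
  strengthen p (var x)  (⊢var ⊢Γ x∈) = ⊢var (strengthenᶜ p ⊢Γ) (strengthen-∈ p x x∈)
  strengthen p (u ^ δ)  (⊢^ ⊢δ u∈)   = ⊢^ (strengthenˢ p δ ⊢δ) u∈
  strengthen p zero     (⊢zero ⊢Γ)   = ⊢zero (strengthenᶜ p ⊢Γ)
  strengthen p (succ t) (⊢succ ⊢t)   = ⊢succ (strengthen p t ⊢t)
  strengthen p (box t)  (⊢box ⊢Γ ⊢t) = ⊢box (strengthenᶜ p ⊢Γ) ⊢t
  strengthen p (letbox s t) (⊢letbox ⊢s ⊢Δ ⊢T ⊢T′ ⊢t) =
    ⊢letbox (strengthen p s ⊢s) ⊢Δ ⊢T ⊢T′ (strengthen (renᶜ-Inserted _ p) t ⊢t)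
  strengthen p (ƛ t)    (⊢ƛ ⊢t)      = ⊢ƛ (strengthen (there p) t ⊢t)
  strengthen p (t · s)  (⊢· ⊢t ⊢s)   = ⊢· (strengthen p t ⊢t) (strengthen p s ⊢s)
  strengthen p (Λ t)    (⊢Λ ⊢Γ ⊢t)   =
    ⊢Λ (strengthenᶜ p ⊢Γ) (strengthen (renᶜ-Inserted _ p) t ⊢t)
  strengthen p (t $ _)  (⊢$ ⊢t ⊢Δ)   = ⊢$ (strengthen p t ⊢t) ⊢Δ

  strengthenˢ : Inserted c Γ Γ′ → ∀ δ → Ψ ⨾ Γ′ ⊢ˢ[ i ] shiftˢ c 1 δ ∶ Δ → Ψ ⨾ Γ ⊢ˢ[ i ] δ ∶ Δ
  strengthenˢ p (∙ m) (⊢∙ ⊢Γ b l) =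
    ⊢∙ (strengthenᶜ p ⊢Γ) (strengthen-base p b) (strengthen-∣∣ p l)
  strengthenˢ p (∙[ g ] m) (⊢∙[] ⊢Γ b l) =
    ⊢∙[] (strengthenᶜ p ⊢Γ) (strengthen-base p b) (strengthen-∣∣ p l)
  strengthenˢ p (wk[ g ] m) (⊢wk ⊢Γ b l) =
    ⊢wk (strengthenᶜ p ⊢Γ) (strengthen-base p b) (strengthen-∣∣ p l)
  strengthenˢ p (δ , t) (⊢, ⊢δ ⊢t) = ⊢, (strengthenˢ p δ ⊢δ) (strengthen p t ⊢t)

η-expansion-typed⇒typed : Ψ ⨾ (Γ , S) ⊢[ i ] t [p^ 1 ] · var 0 ∶ T → Ψ ⨾ Γ ⊢[ i ] t ∶ S ⇒ T
-- Terms carry no annotations, so an application does not fix its argument type; here `var 0` does,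
-- forcing the domain to be `S`.
η-expansion-typed⇒typed (⊢· ⊢t (⊢var _ here)) = strengthen here _ ⊢t

mutual
  -- Equivalence has no reflexivity rule; the congruence rules, one for each typing rule, make it
  -- admissible.
  ≈-refl : Ψ ⨾ Γ ⊢[ i ] t ∶ T → Ψ ⨾ Γ ⊢[ i ] t ≈ t ∶ T
  ≈-refl (⊢var ⊢Γ x∈)              = ≈-var ⊢Γ x∈
  ≈-refl (⊢^ ⊢δ u∈)                = ≈-^ (≈ˢ-refl ⊢δ) u∈
  ≈-refl (⊢zero ⊢Γ)                = ≈-zero ⊢Γ
  ≈-refl (⊢succ ⊢t)                = ≈-succ (≈-refl ⊢t)
  ≈-refl (⊢ƛ ⊢t)                   = ≈-ƛ (≈-refl ⊢t)
  ≈-refl (⊢· ⊢t ⊢s)                = ≈-· (≈-refl ⊢t) (≈-refl ⊢s)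
  ≈-refl (⊢box ⊢Γ ⊢t)              = ≈-box ⊢Γ (≈-refl ⊢t)
  ≈-refl (⊢letbox ⊢s ⊢Δ ⊢T ⊢T′ ⊢t) = ≈-letbox (≈-refl ⊢s) ⊢Δ ⊢T ⊢T′ (≈-refl ⊢t)
  ≈-refl (⊢Λ ⊢Γ ⊢t)                = ≈-Λ ⊢Γ (≈-refl ⊢t)
  ≈-refl (⊢$ ⊢t ⊢Δ)                = ≈-$ (≈-refl ⊢t) ⊢Δ

  ≈ˢ-refl : Ψ ⨾ Γ ⊢ˢ[ i ] δ ∶ Δ → Ψ ⨾ Γ ⊢ˢ[ i ] δ ≈ δ ∶ Δ
  ≈ˢ-refl (⊢∙ ⊢Γ b l)   = ≈-∙ ⊢Γ b l
  ≈ˢ-refl (⊢∙[] ⊢Γ b l) = ≈-∙[] ⊢Γ b l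
  ≈ˢ-refl (⊢wk ⊢Γ b l)  = ≈-wk ⊢Γ b l
  ≈ˢ-refl (⊢, ⊢δ ⊢t)    = ≈-, (≈ˢ-refl ⊢δ) (≈-refl ⊢t)

↝⇒≈ : Ψ ⨾ Γ ⊢ t ↝ t′ ∶ T → Ψ ⨾ Γ ⊢[ 𝟙 ] t ≈ t′ ∶ T
↝⇒≈ (↝-β-ƛ ⊢t ⊢s)                   = β-ƛ ⊢t ⊢s
↝⇒≈ (↝-β-letbox ⊢Γ ⊢s ⊢Δ ⊢T ⊢T′ ⊢t) = β-letbox ⊢Γ ⊢s ⊢Δ ⊢T ⊢T′ ⊢t
↝⇒≈ (↝-β-Λ ⊢Γ ⊢t ⊢Δ)                = β-Λ ⊢Γ ⊢t ⊢Δ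
↝⇒≈ (↝-· r ⊢s)                      = ≈-· (↝⇒≈ r) (≈-refl ⊢s)
↝⇒≈ (↝-$ r ⊢Δ)                      = ≈-$ (↝⇒≈ r) ⊢Δ
↝⇒≈ (↝-letbox r ⊢Δ ⊢T ⊢T′ ⊢t)       = ≈-letbox (↝⇒≈ r) ⊢Δ ⊢T ⊢T′ (≈-refl ⊢t)

↝*⇒≈ : Ψ ⨾ Γ ⊢ t ↝* t′ ∶ T → Ψ ⨾ Γ ⊢[ 𝟙 ] t ≈ t′ ∶ T
↝*⇒≈ (ε ⊢t)   = ≈-refl ⊢t
↝*⇒≈ (r ◅ rs) = ≈-trans (↝⇒≈ r) (↝*⇒≈ rs)

↝-source-typed : Ψ ⨾ Γ ⊢ t ↝ t′ ∶ T → Ψ ⨾ Γ ⊢[ 𝟙 ] t ∶ T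
↝-source-typed (↝-β-ƛ ⊢t ⊢s)                   = ⊢· (⊢ƛ ⊢t) ⊢s
↝-source-typed (↝-β-letbox ⊢Γ ⊢s ⊢Δ ⊢T ⊢T′ ⊢t) = ⊢letbox (⊢box ⊢Γ ⊢s) ⊢Δ ⊢T ⊢T′ ⊢t
↝-source-typed (↝-β-Λ ⊢Γ ⊢t ⊢Δ)                = ⊢$ (⊢Λ ⊢Γ ⊢t) ⊢Δ
↝-source-typed (↝-· r ⊢s)                      = ⊢· (↝-source-typed r) ⊢s
↝-source-typed (↝-$ r ⊢Δ)                      = ⊢$ (↝-source-typed r) ⊢Δ
↝-source-typed (↝-letbox r ⊢Δ ⊢T ⊢T′ ⊢t)       = ⊢letbox (↝-source-typed r) ⊢Δ ⊢T ⊢T′ ⊢t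

↝*-source-typed : Ψ ⨾ Γ ⊢ t ↝* t′ ∶ T → Ψ ⨾ Γ ⊢[ 𝟙 ] t ∶ T
↝*-source-typed (ε ⊢t)  = ⊢t
↝*-source-typed (r ◅ _) = ↝-source-typed r

⟺̂-typed : Ψ ⨾ Γ ⊢ t ⟺̂ t′ ∶ T → Ψ ⨾ Γ ⊢[ 𝟙 ] t ∶ T × Ψ ⨾ Γ ⊢[ 𝟙 ] t′ ∶ T
⟺̂-typed (⟺̂-↝* r r′ _) = ⟨ ↝*-source-typed r , ↝*-source-typed r′ ⟩

mutual
  ⟺̂-sound : Ψ ⨾ Γ ⊢ t ⟺̂ t′ ∶ T → Ψ ⨾ Γ ⊢[ 𝟙 ] t ≈ t′ ∶ T
  ⟺̂-sound (⟺̂-↝* r r′ w⟺w′) =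
    ≈-trans (↝*⇒≈ r) (≈-trans (⟺-sound w⟺w′) (≈-sym (↝*⇒≈ r′)))

  ⟺-sound : Ψ ⨾ Γ ⊢ w ⟺ w′ ∶ T → Ψ ⨾ Γ ⊢[ 𝟙 ] w ≈ w′ ∶ T
  ⟺-sound (⟺-zero ⊢Γ)   = ≈-zero ⊢Γ
  ⟺-sound (⟺-succ e)    = ≈-succ (⟺̂-sound e)
  ⟺-sound (⟺-Nat e)     = ⟷-sound e
  ⟺-sound (⟺-⇒ _ _ e) with ⟨ ⊢l , ⊢r ⟩ ← ⟺̂-typed e =
    ≈-trans (η-⇒ (η-expansion-typed⇒typed ⊢l))
      (≈-trans (≈-ƛ (⟺̂-sound e)) (≈-sym (η-⇒ (η-expansion-typed⇒typed ⊢r))))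
  -- Boxed code is compared syntactically, so reflexivity at layer `𝟘` suffices.
  ⟺-sound (⟺-box ⊢Γ ⊢t) = ≈-box ⊢Γ (≈-refl ⊢t)
  ⟺-sound (⟺-□ e)       = ⟷-sound e
  -- The η argument of `⟺-⇒` again, with the typings for `η-Π` taken from the rule instead of from
  -- strengthening.
  ⟺-sound (⟺-Π _ _ ⊢w ⊢w′ e) =
    ≈-trans (η-Π ⊢w) (≈-trans (≈-Λ (typed⇒wf-ctx ⊢w) (⟺̂-sound e)) (≈-sym (η-Π ⊢w′)))

  ⟷-sound : Ψ ⨾ Γ ⊢ v ⟷ v′ ∶ T → Ψ ⨾ Γ ⊢[ 𝟙 ] v ≈ v′ ∶ T
  ⟷-sound (⟷-var ⊢Γ x∈)      = ≈-var ⊢Γ x∈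
  ⟷-sound (⟷-^ e u∈)         = ≈-^ (⟺̂ˢ-sound e) u∈
  ⟷-sound (⟷-· e e′)         = ≈-· (⟷-sound e) (⟺̂-sound e′)
  -- The bound u ∶ (Δ ⊢ T) is well formed because the global context of the
  -- body is.
  ⟷-sound (⟷-letbox e ⊢T′ e′)
    with ⊢u ⊢Δ ⊢T ← wf-ctx⇒wf-gctx (typed⇒wf-ctx (proj₁ (⟺̂-typed e′)))
    = ≈-letbox (⟷-sound e) ⊢Δ ⊢T ⊢T′ (⟺̂-sound e′)
  ⟷-sound (⟷-$ e ⊢Δ)         = ≈-$ (⟷-sound e) ⊢Δ

  ⟺̂ˢ-sound : Ψ ⨾ Γ ⊢ˢ δ ⟺̂ δ′ ∶ Δ → Ψ ⨾ Γ ⊢ˢ[ 𝟙 ] δ ≈ δ′ ∶ Δ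
  ⟺̂ˢ-sound (⟺̂-∙ ⊢Γ b l)   = ≈-∙ ⊢Γ b l
  ⟺̂ˢ-sound (⟺̂-∙[] ⊢Γ b l) = ≈-∙[] ⊢Γ b l
  ⟺̂ˢ-sound (⟺̂-wk ⊢Γ b l)  = ≈-wk ⊢Γ b l
  ⟺̂ˢ-sound (⟺̂-, e e′)     = ≈-, (⟺̂ˢ-sound e) (⟺̂-sound e′)

theorem3p34 : ∀ {Θ : Scope} {Ψ : GCtx Θ} {Γ : LCtx Θ} →
    (∀ {t t′ : Tm Θ} {T : Ty Θ} → Ψ ⨾ Γ ⊢ t ⟺̂ t′ ∶ T → Ψ ⨾ Γ ⊢[ 𝟙 ] t ≈ t′ ∶ T) ×
    (∀ {w w′ : Tm Θ} {T : Ty Θ} → Ψ ⨾ Γ ⊢ w ⟺ w′ ∶ T → Ψ ⨾ Γ ⊢[ 𝟙 ] w ≈ w′ ∶ T) ×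
    (∀ {v v′ : Tm Θ} {T : Ty Θ} → Ψ ⨾ Γ ⊢ v ⟷ v′ ∶ T → Ψ ⨾ Γ ⊢[ 𝟙 ] v ≈ v′ ∶ T) ×
    (∀ {δ δ′ : LSub Θ} {Δ : LCtx Θ} → Ψ ⨾ Γ ⊢ˢ δ ⟺̂ δ′ ∶ Δ → Ψ ⨾ Γ ⊢ˢ[ 𝟙 ] δ ≈ δ′ ∶ Δ)
theorem3p34 = ⟨ ⟺̂-sound , ⟨ ⟺-sound , ⟨ ⟷-sound , ⟺̂ˢ-sound ⟩ ⟩ ⟩
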